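{- Let $\mathcal H$ be a complete frame expanding the first-order $\Sigma$-structure $\mathcal A$. For every $(\mathcal A,\mathcal H)$-unsatisfiable (possibly infinite) set $\Gamma$ of HoCHCs there exists a finite subset $\Gamma'\subseteq\Gamma$ which is $(\mathcal A,\mathcal H)$-unsatisfiable.
   Context: Types. Fix a base type $\iota$. Argument types $\tau::=\iota\mid\rho$; relational types $\rho::=o\mid\tau\to\rho$; first-order types $\sigma_{FO}::=\iota\mid\iota\to o\mid\iota\to\sigma_{FO}$; types $\sigma::=\rho\mid\sigma_{FO}$. A fixed type environment $\Delta$ maps variables to argument types, $\Delta^{ -1}(\tau)$ infinite for each $\tau$. Signatures are sets of typed symbols distinct from variables and the logical symbols $\neg,\land,\lor,\exists_\tau$. Terms: $M::=x\mid c\mid\neg\mid\land\mid\lor\mid\exists_\tau\mid MM\mid\lambda x.M$, simply typed ($\lambda x.M:\Delta(x)\to\rho$ only for $M$ of relational type $\rho$; $\land,\lor:o\to o\to o$; $\neg M:o$ for $M:o$; $\exists_\tau:(\tau\to o)\to o$). Formulas have type $o$. First-order $\Sigma$-formulas use only first-order-typed symbols, variables of type $\iota$, no $\lambda$. Positive existential: no $\neg$. Semantics: a pre-frame $\mathcal H$ gives nonempty sets $\mathcal H[\![\sigma]\!]$, $\mathcal H[\![o]\!]=\{0,1\}$, function types interpreted by sets of functions, containing $\min,\max$ on $\{0,1\}$ and $E_\tau(r)=\max_{s\in\mathcal H[\![\tau]\!]}r(s)$. Denotation of terms in a $(\Sigma,\mathcal H)$-structure $\mathcal B$ under valuation $\alpha$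 is standard; a frame is a pre-frame in which every positive existential $\lambda x.M$ denotes $r\mapsto[\![M]\!]^{\mathcal B}(\alpha[x\mapsto r])$. $\mathcal B\models F$ iff $F$ has value $1$ under all valuations. Order $\sqsubseteq$: equality on $\iota$, $\le$ on $o$, pointwise on functions; a frame is complete if each $\mathcal H[\![\rho]\!]$ ($\rho$ relational) is closed under pointwise least upper bounds of arbitrary subsets. Background: fixed first-order signature $\Sigma$, first-order $\Sigma$-structure $\mathcal A$, and $\Sigma'\supseteq\Sigma$ adding only relational-typed symbols. $\mathcal H$ expands $\mathcal A$ if $\mathcal H[\![\iota]\!]=\mathcal A[\![\iota]\!]$ and $c^{\mathcal A}\in\mathcal H[\![\sigma]\!]$ for all $c:\sigma\in\Sigma$; a $(\Sigma',\mathcal H)$-expansion of $\mathcal A$ agrees with $\mathcal A$ on $\Sigma$. Clauses: an atom is a $\Sigma'$-formula without logical symbols. Goal clause: $\neg A_1\lor\cdots\lor\neg A_n$; definite clause: $G\lor R\,x_1\cdots x_n$ with $G$ a goal clause, $R\in\Sigma'\setminus\Sigma$, $x_i$ distinct variables; HoCHC: goal or definite clause, free variables universally quantified. $\Gamma$ is $(\mathcal A,\mathcal H)$-satisfiable if some $(\Sigma',\mathcal H)$-expansion of $\mathcal A$ satisfies all clauses in $\Gamma$. -}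

module Defs where

open import Level using (0ℓ)
open import Data.Nat using (ℕ; _≟_)
open import Data.Bool using (Bool; true; false; _∧_; _∨_; not)
open import Data.Product using (Σ; _×_; _,_; ∃; proj₁; proj₂)
open import Data.Sum using (_⊎_)
open import Data.List using (List; []; _∷_; foldr)
open import Data.List.Relation.Unary.All using (All; []; _∷_)
open import Data.List.Relation.Unary.Any using (Any)
open import Data.List.Relation.Unary.Unique.Propositional using (Unique)
open import Data.List.Membership.Propositional using (_∈_)
open import Relation.Binary.PropositionalEquality using (_≡_; refl; subst)
open import Relation.Nullary using (¬_; yes; no; Dec)
open import Function.Bundles using (_⇔_)

infixr 30 _⇒_
data Ty : Set where
  ι o : Ty
  _⇒_ : Ty → Ty → Ty

mutual
  data IsRel : Ty → Set where
    o-rel : IsRel o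
    ⇒-rel : ∀ {τ ρ} → IsArg τ → IsRel ρ → IsRel (τ ⇒ ρ)

  data IsArg : Ty → Set where
    ι-arg   : IsArg ι
    rel-arg : ∀ {ρ} → IsRel ρ → IsArg ρ

data IsFO : Ty → Set where
  fo-ι    : IsFO ι
  fo-pred : IsFO (ι ⇒ o)
  fo-fun  : ∀ {σ} → IsFO σ → IsFO (ι ⇒ σ)

IsType : Ty → Set
IsType σ = IsRel σ ⊎ IsFO σ

_≟Ty_ : (a b : Ty) → Dec (a ≡ b)
ι ≟Ty ι = yes refl
ι ≟Ty o = no (λ ())
ι ≟Ty (_ ⇒ _) = no (λ ())
o ≟Ty ι = no (λ ())
o ≟Ty o = yes refl
o ≟Ty (_ ⇒ _) = no (λ ())
(_ ⇒ _) ≟Ty ι = no (λ ())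
(_ ⇒ _) ≟Ty o = no (λ ())
(a ⇒ b) ≟Ty (c ⇒ d) with a ≟Ty c | b ≟Ty d
... | yes refl | yes refl = yes refl
... | no ne | _ = no (λ { refl → ne refl })
... | yes _ | no ne = no (λ { refl → ne refl })

-- Signatures: fixed first-order Σ and the added relational symbols of Σ'
-- (Σ' = FSym ⊎ RSym)

record FOSig : Set₁ where
  field
    FSym : Set
    fty  : FSym → Ty
    fty-fo : ∀ c → IsFO (fty c)
open FOSig public

record RelSig : Set₁ where
  field
    RSym : Set
    rty  : RSym → Ty
    rty-rel : ∀ R → IsRel (rty R)
open RelSig public

FullDom : Set → Ty → Set
FullDom D ι = D
FullDom D o = Bool
FullDom D (a ⇒ b) = FullDom D a → FullDom D b

record FOStructure (S : FOSig) : Set₁ where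
  field
    D         : Set
    inhabited : D
    interp    : (c : FSym S) → FullDom D (fty S c)
open FOStructure public

-- Pre-frames with H[[ι]] = D.  H[[a → b]] is a set of functions
-- H[[a]] → H[[b]], presented as a carrier Fun a b with an injective
-- (extensional) application map.

CarOf : Set → (Ty → Ty → Set) → Ty → Set
CarOf D F ι = D
CarOf D F o = Bool
CarOf D F (a ⇒ b) = F a b

record PreFrame (D : Set) : Set₁ where
  field
    Fun      : Ty → Ty → Set
    app      : ∀ {a b} → Fun a b → CarOf D Fun a → CarOf D Fun b
    ext      : ∀ {a b} (f g : Fun a b) → (∀ x → app f x ≡ app g x) → f ≡ g
    nonempty : ∀ σ → IsType σ → CarOf D Fun σ
    minF     : Fun o (o ⇒ o)
    maxF     : Fun o (o ⇒ o)
    min-spec : ∀ x y → app (app minF x) y ≡ x ∧ y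
    max-spec : ∀ x y → app (app maxF x) y ≡ x ∨ y
    E        : ∀ σ → IsArg σ → Fun (σ ⇒ o) o
    E-spec   : ∀ σ (p : IsArg σ) (r : Fun σ o) →
               (app (E σ p) r ≡ true) ⇔ (∃ λ s → app r s ≡ true)
open PreFrame public

Car : ∀ {D} → PreFrame D → Ty → Set
Car {D} H = CarOf D (Fun H)

-- Terms over Σ' (variables: pairs (τ , n), Δ (τ , n) = τ)

data Tm (S : FOSig) (R : RelSig) : Ty → Set where
  var  : (σ : Ty) → IsArg σ → ℕ → Tm S R σ
  fsym : (c : FSym S) → Tm S R (fty S c)
  rsym : (r : RSym R) → Tm S R (rty R r)
  tneg : Tm S R o → Tm S R o
  tand : Tm S R (o ⇒ o ⇒ o)
  tor  : Tm S R (o ⇒ o ⇒ o)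
  tex  : (σ : Ty) → IsArg σ → Tm S R ((σ ⇒ o) ⇒ o)
  tapp : ∀ {a b} → Tm S R (a ⇒ b) → Tm S R a → Tm S R b
  tlam : (σ : Ty) → IsArg σ → ℕ → ∀ {ρ} → IsRel ρ → Tm S R ρ → Tm S R (σ ⇒ ρ)

data PosEx {S R} : ∀ {σ} → Tm S R σ → Set where
  pe-var  : ∀ σ p n → PosEx (var σ p n)
  pe-fsym : ∀ c → PosEx (fsym c)
  pe-rsym : ∀ r → PosEx (rsym r)
  pe-and  : PosEx tand
  pe-or   : PosEx tor
  pe-ex   : ∀ σ p → PosEx (tex σ p)
  pe-app  : ∀ {a b} {M : Tm S R (a ⇒ b)} {N : Tm S R a} →
            PosEx M → PosEx N → PosEx (tapp M N)
  pe-lam  : ∀ σ p n {ρ} (r : IsRel ρ) {M : Tm S R ρ} → PosEx M →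
            PosEx (tlam σ p n r M)

data NoLogic {S R} : ∀ {σ} → Tm S R σ → Set where
  nl-var  : ∀ σ p n → NoLogic (var σ p n)
  nl-fsym : ∀ c → NoLogic (fsym c)
  nl-rsym : ∀ r → NoLogic (rsym r)
  nl-app  : ∀ {a b} {M : Tm S R (a ⇒ b)} {N : Tm S R a} →
            NoLogic M → NoLogic N → NoLogic (tapp M N)
  nl-lam  : ∀ σ p n {ρ} (r : IsRel ρ) {M : Tm S R ρ} → NoLogic M →
            NoLogic (tlam σ p n r M)

Atom : FOSig → RelSig → Set
Atom S R = Σ (Tm S R o) NoLogic

arrows : List (Ty × ℕ) → Ty
arrows = foldr (λ v t → proj₁ v ⇒ t) o

data HoCHC (S : FOSig) (R : RelSig) : Set where
  -- ¬A₁ ∨ ⋯ ∨ ¬Aₙ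
  goal     : List (Atom S R) → HoCHC S R
  -- ¬A₁ ∨ ⋯ ∨ ¬Aₙ ∨ r x₁ ⋯ xₘ  with distinct variables xᵢ = (τᵢ , nᵢ)
  definite : List (Atom S R) → (r : RSym R) → (vs : List (Ty × ℕ)) →
             All (λ v → IsArg (proj₁ v)) vs → Unique vs →
             rty R r ≡ arrows vs → HoCHC S R

applyVars : ∀ {S R} (vs : List (Ty × ℕ)) → All (λ v → IsArg (proj₁ v)) vs →
            Tm S R (arrows vs) → Tm S R o
applyVars [] [] t = t
applyVars ((σ , n) ∷ vs) (p ∷ ps) t = applyVars vs ps (tapp t (var σ p n))

headTm : ∀ {S R} (r : RSym R) (vs : List (Ty × ℕ)) →
         All (λ v → IsArg (proj₁ v)) vs → rty R r ≡ arrows vs → Tm S R o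
headTm {S} {R} r vs ps eq = applyVars vs ps (subst (Tm S R) eq (rsym r))

module _ {D : Set} (H : PreFrame D) where

  record Structure (S : FOSig) (R : RelSig) : Set where
    field
      fI : (c : FSym S) → Car H (fty S c)
      rI : (r : RSym R) → Car H (rty R r)
  open Structure public

  Valuation : Set
  Valuation = (σ : Ty) → IsArg σ → ℕ → Car H σ

  update : Valuation → (σ : Ty) → ℕ → Car H σ → Valuation
  update α σ n x σ' p' n' with σ ≟Ty σ' | n ≟ n'
  ... | yes refl | yes refl = x
  ... | _ | _ = α σ' p' n'

  -- denotation relation:  Den B M α v  iff  [[M]]^B(α) = v
  Den : ∀ {S R σ} → Structure S R → Tm S R σ → Valuation → Car H σ → Set
  Den B (var σ p n) α v = α σ p n ≡ v
  Den B (fsym c) α v = fI B c ≡ v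
  Den B (rsym r) α v = rI B r ≡ v
  Den B (tneg M) α v = ∃ λ b → Den B M α b × v ≡ not b
  Den B tand α v = v ≡ minF H
  Den B tor α v = v ≡ maxF H
  Den B (tex σ p) α v = v ≡ E H σ p
  Den B (tapp {a} {b} M N) α v =
    ∃ λ (f : Car H (a ⇒ b)) → ∃ λ (x : Car H a) →
      Den B M α f × Den B N α x × app H f x ≡ v
  Den B (tlam σ p n r M) α f = ∀ x → Den B M (update α σ n x) (app H f x)

  IsFrame : FOSig → RelSig → Set
  IsFrame S R = ∀ (B : Structure S R) (α : Valuation) σ (p : IsArg σ) n {ρ}
    (r : IsRel ρ) (M : Tm S R ρ) → PosEx M → ∃ λ f → Den B (tlam σ p n r M) α f

  PLub : ∀ {ρ} → IsRel ρ → (Car H ρ → Set) → Car H ρ → Set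
  PLub o-rel S u = (u ≡ true) ⇔ (∃ λ b → S b × b ≡ true)
  PLub (⇒-rel _ r) S u =
    ∀ x → PLub r (λ v → ∃ λ f → S f × app H f x ≡ v) (app H u x)

  Complete : Set₁
  Complete = ∀ ρ (r : IsRel ρ) (S : Car H ρ → Set) → ∃ λ u → PLub r S u

  -- x ∈ H[[σ]] is the first-order function y
  Rep : ∀ {σ} → IsFO σ → Car H σ → FullDom D σ → Set
  Rep fo-ι x y = x ≡ y
  Rep fo-pred f g = ∀ d → app H f d ≡ g d
  Rep (fo-fun s) f g = ∀ d → Rep s (app H f d) (g d)

  LitsTrue : ∀ {S R} → Structure S R → Valuation → List (Atom S R) → Set
  LitsTrue B α As = Any (λ A → Den B (proj₁ A) α false) As

  ClauseTrue : ∀ {S R} → Structure S R → HoCHC S R → Valuation → Set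
  ClauseTrue B (goal As) α = LitsTrue B α As
  ClauseTrue B (definite As r vs ps u eq) α =
    LitsTrue B α As ⊎ Den B (headTm r vs ps eq) α true

  Models : ∀ {S R} → Structure S R → HoCHC S R → Set
  Models B C = ∀ α → ClauseTrue B C α

Expands : ∀ {S} (A : FOStructure S) → PreFrame (D A) → Set
Expands {S} A H = ∀ c → ∃ λ x → Rep H (fty-fo S c) x (interp A c)

Satisfiable : ∀ {S R} (A : FOStructure S) (H : PreFrame (D A)) →
              (HoCHC S R → Set) → Set
Satisfiable {S} {R} A H Γ =
  ∃ λ (B : Structure H S R) →
    (∀ c → Rep H (fty-fo S c) (Structure.fI B c) (interp A c)) ×
    (∀ C → Γ C → Models H B C)

{-# OPTIONS --safe #-}
-- Relate an element v of H⟦σ⟧ to a family (u B) indexed by the expansions B of A by a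
-- logical relation which at type o says: if v is true, then some finite Γ' ⊆ Γ forces u B
-- to be true in every B ⊨ Γ'.  It is closed under least upper bounds on the left, and every
-- relational v is related to the constantly true family, so no monotonicity of the elements
-- of H is needed.  Interpret each R by the least upper bound of all v related to (R^B).  By
-- the fundamental lemma, if the body of a clause is true there under α, then some finite Γ'
-- forces it under a valuation that sends the relational variables not in the head to ⊤.
-- For a definite clause, the abstraction of the body over the head variables is therefore
-- related to (R^B), hence lies below R; for a goal clause C, Γ' ∪ {C} is unsatisfiable.
module Submission where

open import Defs
open import Level using (0ℓ)
open import Axiom.ExcludedMiddle using (ExcludedMiddle)
open import Data.Bool using (Bool; true; false)
open import Data.Empty using (⊥-elim)
open import Data.Nat using (ℕ; _≟_)
open import Data.Product using (Σ; ∃; _×_; _,_; proj₁; proj₂)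
open import Data.Sum using (_⊎_; inj₁; inj₂)
open import Data.List using (List; []; _∷_; _++_)
open import Data.List.Relation.Unary.All using (All; []; _∷_; lookup)
open import Data.List.Relation.Unary.All.Properties using (++⁺)
open import Data.List.Relation.Unary.AllPairs using ([]; _∷_)
open import Data.List.Relation.Unary.Any using (here; there)
open import Data.List.Relation.Unary.Unique.Propositional using (Unique)
open import Data.List.Membership.Propositional using (_∈_; _∉_)
open import Data.List.Membership.Propositional.Properties using (∈-++⁺ˡ; ∈-++⁺ʳ)
open import Function using (_∘_)
open import Function.Bundles using (Equivalence)
open import Relation.Binary.PropositionalEquality using (_≡_; _≢_; refl; sym; trans; cong; cong₂; subst)
open import Relation.Nullary using (¬_; yes; no)

-- Type predicates, and terms built from clause bodies.

mutual
  -- Valuations also take a proof of `IsArg`, which `update` ignores; `update-self` therefore has to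
  -- identify any two such proofs.
  IsRel-irrelevant : ∀ {σ} (p q : IsRel σ) → p ≡ q
  IsRel-irrelevant o-rel o-rel = refl
  IsRel-irrelevant (⇒-rel a r) (⇒-rel a' r') =
    cong₂ ⇒-rel (IsArg-irrelevant a a') (IsRel-irrelevant r r')

  IsArg-irrelevant : ∀ {σ} (p q : IsArg σ) → p ≡ q
  IsArg-irrelevant ι-arg ι-arg = refl
  IsArg-irrelevant ι-arg (rel-arg ())
  IsArg-irrelevant (rel-arg ()) ι-arg
  IsArg-irrelevant (rel-arg r) (rel-arg r') = cong rel-arg (IsRel-irrelevant r r')

IsArg⇒IsType : ∀ {σ} → IsArg σ → IsType σ
IsArg⇒IsType ι-arg       = inj₂ fo-ι
IsArg⇒IsType (rel-arg r) = inj₁ r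

ArgVars : List (Ty × ℕ) → Set
ArgVars = All (λ v → IsArg (proj₁ v))

arrows-rel : ∀ {vs} → ArgVars vs → IsRel (arrows vs)
arrows-rel []       = o-rel
arrows-rel (p ∷ ps) = ⇒-rel p (arrows-rel ps)

module _ {S : FOSig} {R : RelSig} where

  NoLogic⇒PosEx : ∀ {σ} {M : Tm S R σ} → NoLogic M → PosEx M
  NoLogic⇒PosEx (nl-var σ p n)     = pe-var σ p n
  NoLogic⇒PosEx (nl-fsym c)        = pe-fsym c
  NoLogic⇒PosEx (nl-rsym r)        = pe-rsym r
  NoLogic⇒PosEx (nl-app m n)       = pe-app (NoLogic⇒PosEx m) (NoLogic⇒PosEx n)
  NoLogic⇒PosEx (nl-lam σ p n r m) = pe-lam σ p n r (NoLogic⇒PosEx m)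

  lamVars : ∀ vs → ArgVars vs → Tm S R o → Tm S R (arrows vs)
  lamVars [] [] M = M
  lamVars ((σ , n) ∷ vs) (p ∷ ps) M = tlam σ p n (arrows-rel ps) (lamVars vs ps M)

  lamVars-PosEx : ∀ vs ps {M} → PosEx M → PosEx (lamVars vs ps M)
  lamVars-PosEx [] [] m = m
  lamVars-PosEx ((σ , n) ∷ vs) (p ∷ ps) m =
    pe-lam σ p n (arrows-rel ps) (lamVars-PosEx vs ps m)

  -- Truth is not a term, so the empty conjunction is ∃x:o. x.
  conj : List (Atom S R) → Tm S R o
  conj []       = tapp (tex o (rel-arg o-rel)) (tlam o (rel-arg o-rel) 0 o-rel (var o (rel-arg o-rel) 0))
  conj (A ∷ As) = tapp (tapp tand (proj₁ A)) (conj As)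

  conj-PosEx : ∀ As → PosEx (conj As)
  conj-PosEx []       = pe-app (pe-ex _ _) (pe-lam _ _ _ _ (pe-var _ _ _))
  conj-PosEx (A ∷ As) = pe-app (pe-app pe-and (NoLogic⇒PosEx (proj₂ A))) (conj-PosEx As)

-- Valuations, denotations and clauses over a pre-frame.

module _ {D : Set} (H : PreFrame D) where

  infix 4 _≗ᵥ_
  _≗ᵥ_ : Valuation H → Valuation H → Set
  α ≗ᵥ β = ∀ σ p n → α σ p n ≡ β σ p n

  update-same : ∀ α σ n x p → update H α σ n x σ p n ≡ x
  update-same α σ n x p with σ ≟Ty σ | n ≟ n
  ... | yes refl | yes refl = refl
  ... | yes refl | no n≢n   = ⊥-elim (n≢n refl)
  ... | no σ≢σ   | _        = ⊥-elim (σ≢σ refl)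

  update-other : ∀ α σ n x σ' p n' → (σ' , n') ≢ (σ , n) →
                 update H α σ n x σ' p n' ≡ α σ' p n'
  update-other α σ n x σ' p n' ne with σ ≟Ty σ' | n ≟ n'
  ... | yes refl | yes refl = ⊥-elim (ne refl)
  ... | yes refl | no _     = refl
  ... | no _     | _        = refl

  update-cong : ∀ {α β} → α ≗ᵥ β → ∀ σ n x → update H α σ n x ≗ᵥ update H β σ n x
  update-cong eq σ n x σ' p n' with σ ≟Ty σ' | n ≟ n'
  ... | yes refl | yes refl = refl
  ... | yes refl | no _     = eq σ' p n'
  ... | no _     | _        = eq σ' p n'

  update-self : ∀ {α β} → α ≗ᵥ β → ∀ σ p n → update H α σ n (β σ p n) ≗ᵥ β
  update-self {β = β} eq σ p n σ' p' n' with σ ≟Ty σ' | n ≟ n'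
  ... | yes refl | yes refl = cong (λ q → β σ q n) (IsArg-irrelevant p p')
  ... | yes refl | no _     = eq σ' p' n'
  ... | no _     | _        = eq σ' p' n'

  applyVals : ∀ vs → ArgVars vs → Valuation H → Car H (arrows vs) → Bool
  applyVals [] [] α f = f
  applyVals ((σ , n) ∷ vs) (p ∷ ps) α f = applyVals vs ps α (app H f (α σ p n))

  -- Applying a pointwise least upper bound to an argument gives the least upper bound of the values
  -- there, so a single member can be followed down to type `o`.
  applyVals-lub : ∀ {σ} vs ps α (eq : σ ≡ arrows vs) (r : IsRel σ) {P : Car H σ → Set} {u} v →
                  PLub H r P u → P (subst (Car H) (sym eq) v) →
                  applyVals vs ps α v ≡ true → applyVals vs ps α (subst (Car H) eq u) ≡ true
  applyVals-lub [] [] α refl o-rel v lub Pv eq = Equivalence.from lub (v , Pv , eq)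
  applyVals-lub ((σ , n) ∷ vs) (p ∷ ps) α refl (⇒-rel _ r) v lub Pv eq =
    applyVals-lub vs ps α refl r (app H v x) (lub x) (v , Pv , refl) eq
    where x = α σ p n

  module _ {S : FOSig} {R : RelSig} where

    -- Two valuations occur because updated valuations are only known to agree pointwise. The
    -- abstraction case is extensionality of the frame.
    Den-unique : ∀ (B : Structure H S R) {σ} (M : Tm S R σ) {α β v w} → α ≗ᵥ β →
                 Den H B M α v → Den H B M β w → v ≡ w
    Den-unique B (var σ p n) eq d e = trans (sym d) (trans (eq σ p n) e)
    Den-unique B (fsym c) eq d e = trans (sym d) e
    Den-unique B (rsym r) eq d e = trans (sym d) e
    Den-unique B (tneg M) eq (b , d , refl) (c , e , refl) with Den-unique B M eq d e
    ... | refl = refl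
    Den-unique B tand eq d e = trans d (sym e)
    Den-unique B tor eq d e = trans d (sym e)
    Den-unique B (tex σ p) eq d e = trans d (sym e)
    Den-unique B (tapp M N) eq (f , x , df , dx , refl) (g , y , dg , dy , refl) =
      cong₂ (app H) (Den-unique B M eq df dg) (Den-unique B N eq dx dy)
    Den-unique B (tlam σ p n r M) eq d e =
      ext H _ _ (λ x → Den-unique B M (update-cong eq σ n x) (d x) (e x))

    -- Iterated β-reduction: giving each binder the value that `β` has there keeps the valuation
    -- pointwise equal to `β`.
    Den-lamVars : ∀ (B : Structure H S R) vs ps M {α β f b} → α ≗ᵥ β →
                  Den H B (lamVars vs ps M) α f → Den H B M β b → applyVals vs ps β f ≡ b
    Den-lamVars B [] [] M eq d e = Den-unique B M eq d e
    Den-lamVars B ((σ , n) ∷ vs) (p ∷ ps) M {β = β} eq d e =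
      Den-lamVars B vs ps M (update-self eq σ p n) (d (β σ p n)) e

    Den-applyVars⁺ : ∀ (B : Structure H S R) vs ps t {α f} → Den H B t α f →
                     Den H B (applyVars vs ps t) α (applyVals vs ps α f)
    Den-applyVars⁺ B [] [] t d = d
    Den-applyVars⁺ B ((σ , n) ∷ vs) (p ∷ ps) t d =
      Den-applyVars⁺ B vs ps (tapp t (var σ p n)) (_ , _ , d , refl , refl)

    Den-applyVars⁻ : ∀ (B : Structure H S R) vs ps t {α b} → Den H B (applyVars vs ps t) α b →
                     ∃ λ f → Den H B t α f × applyVals vs ps α f ≡ b
    Den-applyVars⁻ B [] [] t d = _ , d , refl
    Den-applyVars⁻ B ((σ , n) ∷ vs) (p ∷ ps) t d
      with Den-applyVars⁻ B vs ps (tapp t (var σ p n)) d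
    ... | _ , (f , _ , df , refl , refl) , eq = f , df , eq

    Den-subst-rsym⁺ : ∀ (B : Structure H S R) r {σ} (eq : rty R r ≡ σ) {α} →
                      Den H B (subst (Tm S R) eq (rsym r)) α (subst (Car H) eq (rI B r))
    Den-subst-rsym⁺ B r refl = refl

    Den-subst-rsym⁻ : ∀ (B : Structure H S R) r {σ} (eq : rty R r ≡ σ) {α f} →
                      Den H B (subst (Tm S R) eq (rsym r)) α f → subst (Car H) eq (rI B r) ≡ f
    Den-subst-rsym⁻ B r refl d = d

    Den-headTm⁺ : ∀ (B : Structure H S R) r vs ps eq {α} →
                  applyVals vs ps α (subst (Car H) eq (rI B r)) ≡ true →
                  Den H B (headTm r vs ps eq) α true
    Den-headTm⁺ B r vs ps eq {α} h =
      subst (Den H B (headTm r vs ps eq) α) h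
            (Den-applyVars⁺ B vs ps _ (Den-subst-rsym⁺ B r eq {α}))

    Den-headTm⁻ : ∀ (B : Structure H S R) r vs ps eq {α} →
                  Den H B (headTm r vs ps eq) α true →
                  applyVals vs ps α (subst (Car H) eq (rI B r)) ≡ true
    Den-headTm⁻ B r vs ps eq {α} d with Den-applyVars⁻ B vs ps _ d
    ... | f , df , h = trans (cong (applyVals vs ps α) (Den-subst-rsym⁻ B r eq {α} df)) h

    AllTrue : Structure H S R → Valuation H → List (Atom S R) → Set
    AllTrue B α = All (λ A → Den H B (proj₁ A) α true)

    AllTrue⇒¬LitsTrue : ∀ B {α As} → AllTrue B α As → ¬ LitsTrue H B α As
    AllTrue⇒¬LitsTrue B {As = A ∷ _} (d ∷ _) (here e)
      with Den-unique B (proj₁ A) (λ _ _ _ → refl) d e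
    ... | ()
    AllTrue⇒¬LitsTrue B (_ ∷ ds) (there l) = AllTrue⇒¬LitsTrue B ds l

    AllTrue⇒head : ∀ B {As} r vs ps {u} eq {α} → Models H B (definite As r vs ps u eq) →
                   AllTrue B α As → applyVals vs ps α (subst (Car H) eq (rI B r)) ≡ true
    AllTrue⇒head B r vs ps eq {α} m ds with m α
    ... | inj₁ l = ⊥-elim (AllTrue⇒¬LitsTrue B ds l)
    ... | inj₂ d = Den-headTm⁻ B r vs ps eq d

    Den-conj⁻ : ∀ B As {α} → Den H B (conj As) α true → AllTrue B α As
    Den-conj⁻ B [] _ = []
    Den-conj⁻ B (A ∷ As) (_ , y , (_ , x , refl , dx , refl) , dy , eq)
      with x | y | trans (sym (min-spec H x y)) eq
    ... | true | true | _ = dx ∷ Den-conj⁻ B As dy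

    -- Total denotations and constant functions in a frame.

    module _ (frame : IsFrame H S R) where

      Den-total : ∀ (B : Structure H S R) {σ} {M : Tm S R σ} → PosEx M → ∀ α → ∃ (Den H B M α)
      Den-total B (pe-var σ p n) α = _ , refl
      Den-total B (pe-fsym c) α = _ , refl
      Den-total B (pe-rsym r) α = _ , refl
      Den-total B pe-and α = _ , refl
      Den-total B pe-or α = _ , refl
      Den-total B (pe-ex σ p) α = _ , refl
      Den-total B (pe-app m n) α with Den-total B m α | Den-total B n α
      ... | f , df | x , dx = _ , f , x , df , dx , refl
      Den-total B (pe-lam σ p n r {M} m) α = frame B α σ p n r M m

      Den-conj⁺ : ∀ B As {α} → AllTrue B α As → Den H B (conj As) α true
      Den-conj⁺ B [] {α} [] with frame B α o (rel-arg o-rel) 0 o-rel (var o (rel-arg o-rel) 0) (pe-var _ _ _)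
      ... | f , df = _ , f , refl , df , Equivalence.from (E-spec H o (rel-arg o-rel) f) (true , sym (df true))
      Den-conj⁺ B (A ∷ As) (d ∷ ds) =
        _ , true , (_ , true , refl , d , refl) , Den-conj⁺ B As ds , min-spec H true true

      LitsTrue⊎AllTrue : ∀ B α As → LitsTrue H B α As ⊎ AllTrue B α As
      LitsTrue⊎AllTrue B α [] = inj₂ []
      LitsTrue⊎AllTrue B α (A ∷ As)
        with Den-total B (NoLogic⇒PosEx (proj₂ A)) α | LitsTrue⊎AllTrue B α As
      ... | false , d | _       = inj₁ (here d)
      ... | true  , _ | inj₁ l  = inj₁ (there l)
      ... | true  , d | inj₂ ds = inj₂ (d ∷ ds)

      module _ (B : Structure H S R) where

        constant : ∀ {σ ρ} → IsArg σ → IsRel ρ → (y : Car H ρ) →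
                   ∃ λ (f : Car H (σ ⇒ ρ)) → ∀ x → app H f x ≡ y
        constant {σ} {ρ} a r y
          -- The function is `λ x. y` with the value `y` held by a variable. Index 1 for it and 0
          -- for the bound variable keep the two apart even if `σ` and `ρ` coincide.
          with frame B (update H (λ τ p _ → nonempty H τ (IsArg⇒IsType p)) ρ 1 y) σ a 0 r
                 (var ρ (rel-arg r) 1) (pe-var _ _ _)
        ... | f , df = f , λ x → trans (sym (df x))
          (trans (update-other _ σ 0 x ρ (rel-arg r) 1 (λ ())) (update-same _ ρ 1 y (rel-arg r)))

        top : ∀ {ρ} → IsRel ρ → Car H ρ
        top o-rel       = true
        top (⇒-rel a r) = proj₁ (constant a r (top r))

        app-top : ∀ {σ ρ} (a : IsArg σ) (r : IsRel ρ) x → app H (top (⇒-rel a r)) x ≡ top r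
        app-top a r = proj₂ (constant a r (top r))

        -- Values of type `ι` stay, since relatedness there is equality; relational ones can become
        -- ⊤ by `Related-top`.
        raise : Valuation H → Valuation H
        raise α _ ι-arg       n = α ι ι-arg n
        raise α _ (rel-arg r) n = top r

-- Finite forcing and the logical relation.

module _ {S : FOSig} {R : RelSig} (A : FOStructure S) (H : PreFrame (D A))
         (Γ : HoCHC S R → Set) where

  Expansion : Set
  Expansion = Σ (Structure H S R) λ B → ∀ c → Rep H (fty-fo S c) (fI B c) (interp A c)

  Family : Ty → Set
  Family σ = Expansion → Car H σ

  FinitelyForced : (Expansion → Set) → Set
  FinitelyForced P = ∃ λ (Γ' : List (HoCHC S R)) →
    All Γ Γ' × (∀ B → (∀ C → C ∈ Γ' → Models H (proj₁ B) C) → P B)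

  forced-pure : ∀ {P} → (∀ B → P B) → FinitelyForced P
  forced-pure h = [] , [] , λ B _ → h B

  forced-map : ∀ {P Q} → (∀ B → P B → Q B) → FinitelyForced P → FinitelyForced Q
  forced-map h (Γ' , a , f) = Γ' , a , λ B m → h B (f B m)

  forced-clause : ∀ {C} → Γ C → FinitelyForced (λ B → Models H (proj₁ B) C)
  forced-clause {C} c = C ∷ [] , c ∷ [] , λ B m → m C (here refl)

  forced-zip : ∀ {P Q T} → (∀ B → P B → Q B → T B) →
               FinitelyForced P → FinitelyForced Q → FinitelyForced T
  forced-zip h (Γ₁ , a₁ , f₁) (Γ₂ , a₂ , f₂) = Γ₁ ++ Γ₂ , ++⁺ a₁ a₂ , λ B m →
    h B (f₁ B (λ C → m C ∘ ∈-++⁺ˡ)) (f₂ B (λ C → m C ∘ ∈-++⁺ʳ Γ₁))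

  -- The finite list is chosen only at type `o`, so it may depend on all arguments supplied before.
  Related : ∀ σ → Car H σ → Family σ → Set
  Related ι       d u = ∀ B → u B ≡ d
  Related o       b u = b ≡ true → FinitelyForced (λ B → u B ≡ true)
  Related (σ ⇒ τ) f u = ∀ s t → Related σ s t → Related τ (app H f s) (λ B → app H (u B) (t B))

  -- Stands in for function extensionality on families.
  Related-cong : ∀ σ {v u u'} → (∀ B → u B ≡ u' B) → Related σ v u → Related σ v u'
  Related-cong ι       eq h B     = trans (sym (eq B)) (h B)
  Related-cong o       eq h b     = forced-map (λ B → trans (sym (eq B))) (h b)
  Related-cong (σ ⇒ τ) eq h s t k = Related-cong τ (λ B → cong (λ f → app H f (t B)) (eq B)) (h s t k)

  Related-subst : ∀ {σ τ} (eq : σ ≡ τ) {v u} → Related τ v (λ B → subst (Car H) eq (u B)) →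
                  Related σ (subst (Car H) (sym eq) v) u
  Related-subst refl h = h

  -- The source of compactness: at type `o` a true least upper bound has one true member, and the
  -- finite list of that member suffices, however large `P` is.
  Related-lub : ∀ {ρ} (r : IsRel ρ) {P : Car H ρ → Set} {v u} → PLub H r P v →
                (∀ w → P w → Related ρ w u) → Related ρ v u
  Related-lub o-rel lub h eq with Equivalence.to lub eq
  ... | b , Pb , b≡true = h b Pb b≡true
  Related-lub (⇒-rel _ r) lub h s t k =
    Related-lub r (lub s) (λ { _ (f , Pf , refl) → h f Pf s t k })

  -- All expansions agree with `A` on these symbols, and arguments have type `ι`, where related
  -- means equal; a true value is thus forced by the empty list.
  Related-Rep : ∀ {σ} (q : IsFO σ) {v u g} → Rep H q v g → (∀ B → Rep H q (u B) g) → Related σ v u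
  Related-Rep fo-ι refl h B = h B
  Related-Rep fo-pred rep h s t k eq = forced-pure λ B →
    trans (cong (app H _) (k B)) (trans (h B s) (trans (sym (rep s)) eq))
  Related-Rep (fo-fun q) {u = u} rep h s t k =
    Related-cong _ (λ B → cong (app H (u B)) (sym (k B))) (Related-Rep q (rep s) (λ B → h B s))

  Relatedᵥ : Valuation H → (Expansion → Valuation H) → Set
  Relatedᵥ α β = ∀ σ p n → Related σ (α σ p n) (λ B → β B σ p n)

  Relatedᵥ-update : ∀ {α β} → Relatedᵥ α β → ∀ σ n {x u} → Related σ x u →
                    Relatedᵥ (update H α σ n x) (λ B → update H (β B) σ n (u B))
  Relatedᵥ-update h σ n k σ' p n' with σ ≟Ty σ' | n ≟ n'
  ... | yes refl | yes refl = k
  ... | yes refl | no _     = h σ' p n'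
  ... | no _     | _        = h σ' p n'

  FiniteUnsat : Set
  FiniteUnsat = ∃ λ (Γ' : List (HoCHC S R)) → All Γ Γ' × ¬ Satisfiable A H (λ C → C ∈ Γ')

  -- The model given by least upper bounds.

  module _ (frame : IsFrame H S R) (complete : Complete H) (expands : Expands A H) where

    -- The bound is used twice: it is itself related to the family of interpretations
    -- (`Related-rI`), and it lies above every related element, which makes definite clauses true.
    model : Structure H S R
    model = record
      { fI = λ c → proj₁ (expands c)
      ; rI = λ r → proj₁ (complete _ (rty-rel R r) (λ v → Related (rty R r) v (λ B → rI (proj₁ B) r)))
      }

    Related-top : ∀ {ρ} (r : IsRel ρ) {v} → Related ρ v (λ _ → top H frame model r)
    Related-top o-rel eq = forced-pure λ _ → refl
    Related-top (⇒-rel a r) s t k =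
      Related-cong _ (λ B → sym (app-top H frame model a r (t B))) (Related-top r)

    Relatedᵥ-raise : ∀ α → Relatedᵥ α (λ _ → raise H frame model α)
    Relatedᵥ-raise α _ ι-arg       n B = refl
    Relatedᵥ-raise α _ (rel-arg r) n   = Related-top r

    Related-rI : ∀ r → Related (rty R r) (rI model r) (λ B → rI (proj₁ B) r)
    Related-rI r = Related-lub (rty-rel R r) (proj₂ (complete _ (rty-rel R r) _)) (λ _ h → h)

    -- Induction on the term. For an application, the functions and arguments that `e` supplies in
    -- each expansion form the families for the two subterms.
    fundamental : ∀ {σ} {M : Tm S R σ} → NoLogic M → ∀ {α β v u} → Relatedᵥ α β →
                  Den H model M α v → (∀ B → Den H (proj₁ B) M (β B) (u B)) → Related σ v u
    fundamental (nl-var σ p n) h refl e = Related-cong σ e (h σ p n)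
    fundamental (nl-fsym c) h refl e =
      Related-cong _ e (Related-Rep (fty-fo S c) (proj₂ (expands c)) (λ B → proj₂ B c))
    fundamental (nl-rsym r) h refl e = Related-cong _ e (Related-rI r)
    fundamental (nl-app m n) h (f , x , df , dx , refl) e =
      Related-cong _ (λ B → proj₂ (proj₂ (proj₂ (proj₂ (e B)))))
        (fundamental m h df (λ B → proj₁ (proj₂ (proj₂ (e B)))) x _
          (fundamental n h dx (λ B → proj₁ (proj₂ (proj₂ (proj₂ (e B)))))))
    fundamental (nl-lam σ p n r m) h d e s t k =
      fundamental m (Relatedᵥ-update h σ n k) (d s) (λ B → e B (t B))

    forced-AllTrue : ∀ {α β} → Relatedᵥ α β → ∀ {As} → AllTrue H model α As →
                     FinitelyForced (λ B → AllTrue H (proj₁ B) (β B) As)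
    forced-AllTrue h [] = forced-pure λ _ → []
    forced-AllTrue {β = β} h {A ∷ As} (d ∷ ds) =
      forced-zip (λ B eq ds' → subst (Den H (proj₁ B) (proj₁ A) (β B)) eq (proj₂ (value B)) ∷ ds')
        (fundamental (proj₂ A) h d (λ B → proj₂ (value B)) refl) (forced-AllTrue h ds)
      where
      value : ∀ B → ∃ (Den H (proj₁ B) (proj₁ A) (β B))
      value B = Den-total H frame (proj₁ B) (NoLogic⇒PosEx (proj₂ A)) (β B)

    -- The hypothesis "β' agrees with β off vs" keeps the head variables that are already bound
    -- fixed during the induction; distinctness of vs is what makes it applicable.
    Related-lamVars : ∀ vs ps → Unique vs → ∀ M {α β f u} → Relatedᵥ α β →
      Den H model (lamVars vs ps M) α f →
      (∀ α' β' → Relatedᵥ α' β' →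
        (∀ B σ p n → (σ , n) ∉ vs → β' B σ p n ≡ β B σ p n) →
        Den H model M α' true → FinitelyForced (λ B → applyVals H vs ps (β' B) (u B) ≡ true)) →
      Related (arrows vs) f u
    Related-lamVars [] [] _ M h d k refl = k _ _ h (λ _ _ _ _ _ → refl) d
    Related-lamVars ((σ , n) ∷ vs) (p ∷ ps) (x∉vs ∷ uq) M {β = β} {u = u} h d k s t l =
      Related-lamVars vs ps uq M (Relatedᵥ-update h σ n l) (d s) λ α' β' h' agree d' →
        forced-map
          (λ B → trans (cong (λ y → applyVals H vs ps (β' B) (app H (u B) y))
                    (sym (trans (agree B σ p n (λ i → lookup x∉vs i refl))
                                (update-same H (β B) σ n (t B) p)))))
          (k α' β' h'
            (λ B σ' p' n' ∉ → trans (agree B σ' p' n' (∉ ∘ there))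
                                    (update-other H (β B) σ n (t B) σ' p' n' (∉ ∘ here)))
            d')

    model-definite : ∀ {As r vs ps uq eq} → Γ (definite As r vs ps uq eq) →
                     Models H model (definite As r vs ps uq eq)
    model-definite {As} {r} {vs} {ps} {uq} {eq} C∈Γ α with LitsTrue⊎AllTrue H frame model α As
    ... | inj₁ l  = inj₁ l
    ... | inj₂ ds = inj₂ (Den-headTm⁺ H model r vs ps eq
      -- `body` is true at the head variables and belongs to the set whose least upper bound
      -- interprets `r`, so the head is true as well.
      (applyVals-lub H vs ps α eq (rty-rel R r) body (proj₂ (complete _ (rty-rel R r) _))
        (Related-subst eq (Related-lamVars vs ps uq (conj As) (Relatedᵥ-raise α) (proj₂ body-Den)
          -- Adding the clause itself to the list that forces its atoms forces its head.
          λ α' β' h _ d → forced-zip (λ B → AllTrue⇒head H (proj₁ B) r vs ps {uq} eq)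
            (forced-clause C∈Γ) (forced-AllTrue h (Den-conj⁻ H model As d))))
        (Den-lamVars H model vs ps (conj As) (λ _ _ _ → refl) (proj₂ body-Den)
          (Den-conj⁺ H frame model As ds))))
      where
      body-Den : ∃ (Den H model (lamVars vs ps (conj As)) α)
      body-Den = Den-total H frame model (lamVars-PosEx vs ps (conj-PosEx As)) α
      body : Car H (arrows vs)
      body = proj₁ body-Den

    model-goal : ¬ FiniteUnsat → ∀ {As} → Γ (goal As) → Models H model (goal As)
    model-goal fin {As} C∈Γ α with LitsTrue⊎AllTrue H frame model α As
    ... | inj₁ l  = l
    -- The forced property is absurdity: the list forces all atoms of the goal clause and also
    -- contains that clause, so no expansion satisfies it.
    ... | inj₂ ds with forced-zip (λ B ds' m → AllTrue⇒¬LitsTrue H (proj₁ B) ds' (m _))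
                         (forced-AllTrue (Relatedᵥ-raise α) ds) (forced-clause C∈Γ)
    ... | Γ' , a , f = ⊥-elim (fin (Γ' , a , λ (B , rep , m) → f (B , rep) m))

    model-satisfies : ¬ FiniteUnsat → Satisfiable A H Γ
    model-satisfies fin = model , (λ c → proj₂ (expands c)) , λ where
      (goal _)               → model-goal fin
      (definite _ _ _ _ _ _) → model-definite

mainTheorem3 : ExcludedMiddle 0ℓ →
    (S : FOSig) (R : RelSig) (A : FOStructure S) (H : PreFrame (D A)) →
    IsFrame H S R → Complete H → Expands A H →
    (Γ : HoCHC S R → Set) → ¬ Satisfiable A H Γ →
    ∃ λ (Γ' : List (HoCHC S R)) → All Γ Γ' × ¬ Satisfiable A H (λ C → C ∈ Γ')
mainTheorem3 em S R A H frame complete expands Γ unsat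
  -- The only appeal to excluded middle: without a finite unsatisfiable subset, `model` would
  -- satisfy `Γ`.
  with em {FiniteUnsat A H Γ}
... | yes fin = fin
... | no ¬fin = ⊥-elim (unsat (model-satisfies A H Γ frame complete expands ¬fin))
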